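{- There is no deterministic distributed algorithm in the LOCAL model that finds a maximal half-integral matching in every graph of maximum degree at most $4$ in $o(\log^* n)$ rounds, where $n$ is the number of nodes of the input graph.
   Context: Fractional matching: for a finite simple graph $G=(V,E)$ and $x\colon E\to[0,1]$, write $x[v]=\sum_{e\in E: v\in e} x(e)$ for $v \in V$. The function $x$ is a fractional matching if $x[v]\le 1$ for all $v\in V$; it is a maximal fractional matching if in addition for every edge $\{u,v\}\in E$ at least one endpoint is saturated, i.e. $x[u]=1$ or $x[v]=1$. A maximal half-integral matching is a maximal fractional matching $x$ with $x(e)\in\{0,\frac12,1\}$ for every $e\in E$. PN (port-numbering) model: each node of the input graph $G$ is a computer and each edge is a communication link. An adversary chooses a port numbering: each node $v$ of degree $\deg(v)$ refers to its incident edges by the numbers $1,\dotsc,\deg(v)$. Initially each node knows only its degree (and the global maximum degree bound), and nodes of the same degree start in the same state. Computation is deterministic and proceeds in synchronous rounds; in each round each node sends a message (of arbitrary size) through each port, receives a message from each port, and updates its state by arbitrary local computation as a function of its current state and the received messages. A node may stop after any number of rounds and announce its local output, here the value $x(e)$ of each incident edge $e$ (the two endpoints of an edge must announce the same value). The running time is the number of rounds until all nodes have stopped; as a function of $n$ it is the worst case over all inputs with $n$ nodes. An algorithm must be correct for every input graph in the family and every port numbering. LOCAL model: the same as the PN model, except that each node is additionally given as input a unique identifier, chosen by an adversary from a set of size polynomial in $n=|V|$, e.g. $\{1,\dotsc,n^c\}$ for a fixed constant $c \ge 1$. An algorithm must be correct for every choice of unique identifiers. $\log^* n$ denotes the iterated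 logarithm. -}

module Defs where

open import Algebra.Properties.Monoid.Sum using (sum)
open import Data.Bool using (if_then_else_)
open import Data.Fin using (Fin)
open import Data.Fin.Subset using (Subset; _∈_; _∉_; ∣_∣)
open import Data.Maybe using (Maybe; just; nothing)
open import Data.Nat as ℕ using (ℕ; zero; suc; _≤ᵇ_)
open import Data.Nat.Logarithm using (⌈log₂_⌉)
open import Data.Product using (∃; _×_; _,_; proj₁; proj₂)
open import Data.Rational using (ℚ; 0ℚ; ½; 1ℚ; _≤_)
open import Data.Rational.Properties using (+-0-monoid)
open import Data.Sum using (_⊎_)
open import Data.Vec using (Vec; lookup; tabulate)
open import Function.Bundles using (_↔_; Inverse)
open import Relation.Binary.PropositionalEquality using (_≡_)

------------------------------------------------------------------------
-- Graphs and fractional matchings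

record SimpleGraph (n : ℕ) : Set where
  field
    neighbours : Fin n → Subset n
    symmetric  : ∀ {u v} → v ∈ neighbours u → u ∈ neighbours v
    loopless   : ∀ {v} → v ∉ neighbours v

  deg : Fin n → ℕ
  deg v = ∣ neighbours v ∣

  MaxDegree≤ : ℕ → Set
  MaxDegree≤ Δ = ∀ v → deg v ℕ.≤ Δ

-- A function x on the edges is represented by x : Fin n → Fin n → ℚ, where
-- x u v is the value of the edge {u,v}; values at non-adjacent pairs are
-- never used.

module _ {n : ℕ} (G : SimpleGraph n) (x : Fin n → Fin n → ℚ) where
  open SimpleGraph G

  -- x[v], the sum of x over the edges incident to v.
  load : Fin n → ℚ
  load v = sum +-0-monoid {n} λ u →
    if lookup (neighbours v) u then x v u else 0ℚ

  record IsFractionalMatching : Set where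
    field
      well-defined : ∀ {u v} → v ∈ neighbours u → x u v ≡ x v u
      nonnegative  : ∀ {u v} → v ∈ neighbours u → 0ℚ ≤ x u v
      at-most-one  : ∀ {u v} → v ∈ neighbours u → x u v ≤ 1ℚ
      load≤1       : ∀ v → load v ≤ 1ℚ

  record IsMaximalFractionalMatching : Set where
    field
      isFractionalMatching : IsFractionalMatching
      saturated : ∀ {u v} → v ∈ neighbours u → load u ≡ 1ℚ ⊎ load v ≡ 1ℚ

  record IsMaximalHalfIntegralMatching : Set where
    field
      isMaximalFractionalMatching : IsMaximalFractionalMatching
      halfIntegral : ∀ {u v} → v ∈ neighbours u →
                     x u v ≡ 0ℚ ⊎ x u v ≡ ½ ⊎ x u v ≡ 1ℚ

------------------------------------------------------------------------
-- The LOCAL model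

module _ {n : ℕ} (G : SimpleGraph n) where
  open SimpleGraph G

  PortNumbering : Set
  PortNumbering = ∀ v → Fin (deg v) ↔ ∃ λ u → u ∈ neighbours v

  record Identifiers (c : ℕ) : Set where
    field
      id       : Fin n → ℕ
      positive : ∀ v → 1 ℕ.≤ id v
      bounded  : ∀ v → id v ℕ.≤ n ℕ.^ c
      unique   : ∀ {u v} → id u ≡ id v → u ≡ v

-- State d is the state space of the nodes of degree d; component i of a
-- vector of messages or of local outputs belongs to port i. A node has
-- stopped once its state has an output. The initial state depends on the
-- degree and the identifier only; in particular, n is not given to the nodes.
record LocalAlgorithm (Output : Set) : Set₁ where
  field
    State   : ℕ → Set
    Message : Set
    init    : (d : ℕ) (id : ℕ) → State d
    send    : ∀ {d} → State d → Vec Message d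
    receive : ∀ {d} → State d → Vec Message d → State d
    output  : ∀ {d} → State d → Maybe (Vec Output d)

  -- A stopped node keeps its state forever.
  update : ∀ {d} → State d → Vec Message d → State d
  update s m with output s
  ... | just _  = s
  ... | nothing = receive s m

module Execution {Output : Set} (A : LocalAlgorithm Output)
                 {n c : ℕ} (G : SimpleGraph n)
                 (P : PortNumbering G) (I : Identifiers G c) where
  open LocalAlgorithm A
  open SimpleGraph G
  open Identifiers I

  neighbour : (v : Fin n) → Fin (deg v) → Fin n
  neighbour v i = proj₁ (Inverse.to (P v) i)

  -- The number given by the neighbour to the same edge.
  oppositePort : (v : Fin n) (i : Fin (deg v)) → Fin (deg (neighbour v i))
  oppositePort v i =
    Inverse.from (P (neighbour v i)) (v , symmetric (proj₂ (Inverse.to (P v) i)))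

  -- The state of a node after t rounds.
  state : (t : ℕ) (v : Fin n) → State (deg v)
  state zero    v = init (deg v) (id v)
  state (suc t) v = update (state t v) (tabulate λ i →
    lookup (send (state t (neighbour v i))) (oppositePort v i))

  -- Within t rounds every node has stopped, having announced the value x
  -- of each of its incident edges.
  AnnouncesWithin : ℕ → (Fin n → Fin n → Output) → Set
  AnnouncesWithin t x =
    ∀ v → output (state t v) ≡ just (tabulate λ i → x v (neighbour v i))

-- On n-node graphs of maximum degree at most Δ with identifiers from
-- {1,…,n^c}, the worst-case running time of A is at most T n and its output
-- is always a maximal half-integral matching.
FindsMaximalHalfIntegralMatching :
  (Δ c : ℕ) → LocalAlgorithm ℚ → (T : ℕ → ℕ) → Set
FindsMaximalHalfIntegralMatching Δ c A T =
  ∀ {n} (G : SimpleGraph n) → SimpleGraph.MaxDegree≤ G Δ →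
  (P : PortNumbering G) (I : Identifiers G c) →
  ∃ λ x → Execution.AnnouncesWithin A G P I (T n) x
        × IsMaximalHalfIntegralMatching G x

------------------------------------------------------------------------
-- Asymptotics

-- Number of times log₂ is applied until the value is at most 1. Rounding up
-- at each step does not change this number, since for an integer m we have
-- log₂ y ≤ m iff log₂ ⌈y⌉ ≤ m. The first argument is fuel; n is enough since
-- ⌈log₂ n⌉ < n for n ≥ 2.
iteratedLog : (fuel n : ℕ) → ℕ
iteratedLog zero       n = 0
iteratedLog (suc fuel) n =
  if n ≤ᵇ 1 then 0 else suc (iteratedLog fuel ⌈log₂ n ⌉)

log* : ℕ → ℕ
log* n = iteratedLog n n

-- f = o(g): for each ε = 1/k, f n ≤ ε · g n for all sufficiently large n.
_∈o[_] : (f g : ℕ → ℕ) → Set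
f ∈o[ g ] = ∀ k → ∃ λ N → ∀ n → N ℕ.≤ n → k ℕ.* f n ℕ.≤ g n

{-# OPTIONS --safe #-}
module Submission where

-- Node number v gets identifier v + 1, and the nodes are the pairs (a, b) in
-- Fin N × Fin R. Increasing sequences c in Fin N and r in Fin R span a grid, whose
-- node (i, j) is the pair (c i, r j). Within t rounds the output at a node
-- depends only on the entries of c and r at distance at most t + 1. If N is a
-- tower of height O(t) over R, Linial's argument on shifted tuples yields c such
-- that two adjacent columns in the middle have equal outputs for every r, and
-- then r is chosen likewise for two adjacent rows.
--
-- Adjacent nodes with equal outputs have equal loads, so both are saturated.
-- Hence every node of the middle column is saturated and has equal values
-- to its left and right, so the values above and below it sum to an
-- integer. Starting at the lower boundary, where the value below is absent, all
-- vertical values of the column up to the centre are integers. In the same way the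
-- horizontal values of the middle row are integers. The centre then has
-- load 2p + 2q with integers p and q, which is not 1.

open import Defs
open import Data.Bool using (Bool; true; false; if_then_else_; _∨_; T)
open import Data.Empty using (⊥; ⊥-elim)
open import Data.Fin as Fin
  using (Fin; zero; suc; toℕ; fromℕ<; combine; remQuot; funToFin; finToFun)
open import Data.Fin.Patterns using (0F; 1F; 2F; 3F)
import Data.Fin.Properties as Finₚ
open import Data.Fin.Subset as Subset using (Subset; inside; outside; _∈_; ∣_∣; ⁅_⁆; _∪_)
open import Data.Fin.Subset.Properties
  using (∉⊥; x∈⁅x⁆; x∈⁅y⁆⇒x≡y; ∣⊥∣≡0; ∣⁅x⁆∣≡1; x∈p∪q⁺; x∈p∪q⁻)
open import Data.Maybe using (Maybe; just; nothing; maybe; map)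
open import Data.Maybe.Properties using (just-injective)
open import Data.Nat
  using (ℕ; zero; suc; _+_; _*_; _^_; _≤_; _<_; _≤ᵇ_; _≤′_; _<′_; z≤n; s≤s; ≤′-refl; ≤′-step)
open import Data.Nat.Logarithm using (⌈log₂⌉-mono-≤; ⌈log₂2^n⌉≡n)
open import Data.Nat.Properties
open import Data.Nat.Tactic.RingSolver using (solve-∀)
open import Data.Product using (∃; _×_; _,_; proj₁; proj₂; uncurry)
open import Data.Rational as ℚ using (ℚ; 0ℚ; ½; 1ℚ)
import Data.Rational.Properties as ℚₚ
open import Algebra.Properties.CommutativeMonoid.Sum ℚₚ.+-0-commutativeMonoid
  using (sum; sum-cong-≗; sum-replicate-zero; ∑-distrib-+)
open import Data.Sum using (_⊎_; inj₁; inj₂)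
open import Data.Vec using (Vec; []; _∷_; here; there; lookup; tabulate; init; tail)
open import Data.Vec.Properties
  using (tabulate-cong; lookup∘tabulate; tabulate∘lookup; lookup-zipWith; lookup-replicate; lookup⇒[]=)
open import Data.Vec.Properties.WithK using ([]=-irrelevant)
open import Function using (_∘_)
open import Function.Bundles using (_↔_; mk↔ₛ′)
open import Relation.Binary.Definitions using (tri<; tri≈; tri>)
open import Relation.Binary.PropositionalEquality
  using (_≡_; _≢_; refl; sym; trans; cong; cong₂; subst; subst₂; module ≡-Reasoning)
open import Relation.Nullary using (¬_; Dec; does; yes; no)
open import Relation.Nullary.Decidable using (_×-dec_)

-- Towers and the iterated logarithm

tower : ℕ → ℕ
tower zero    = 1
tower (suc h) = 2 ^ tower h

-- The exponential is applied to the argument before recursing, as in `shift`, which replaces a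
-- palette of `k` colours by its `2 ^ k` subsets and then shortens the tuple.
iteratedExp : ℕ → ℕ → ℕ
iteratedExp zero    k = k
iteratedExp (suc m) k = iteratedExp m (2 ^ k)

-- One rounded logarithm lowers a tower by one level. Running out of fuel returns 0, so the upper
-- bound holds for any amount of fuel.
iteratedLog-tower : ∀ fuel h {n} → n ≤ tower h → iteratedLog fuel n ≤ h
iteratedLog-tower zero       h       n≤   = z≤n
iteratedLog-tower (suc fuel) h {n}   n≤ with n ≤ᵇ 1 in eq
iteratedLog-tower (suc fuel) h       n≤ | true = z≤n
iteratedLog-tower (suc fuel) zero    n≤ | false with () ← subst T eq (≤⇒≤ᵇ n≤)
iteratedLog-tower (suc fuel) (suc h) n≤ | false =
  s≤s (iteratedLog-tower fuel h
    (≤-trans (⌈log₂⌉-mono-≤ n≤) (≤-reflexive (⌈log₂2^n⌉≡n (tower h)))))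

n<2^n : ∀ n → n < 2 ^ n
n<2^n zero    = s≤s z≤n
n<2^n (suc n) = begin-strict
  suc n         <⟨ s≤s (n<2^n n) ⟩
  1 + 2 ^ n     ≤⟨ +-monoˡ-≤ (2 ^ n) (m^n>0 2 n) ⟩
  2 ^ n + 2 ^ n ≡⟨ cong (2 ^ n +_) (+-identityʳ (2 ^ n)) ⟨
  2 ^ suc n     ∎
  where open ≤-Reasoning

2n≤2^n : ∀ n → 0 < n → 2 * n ≤ 2 ^ n
2n≤2^n (suc n) _ = *-monoʳ-≤ 2 (n<2^n n)

tower>0 : ∀ h → 0 < tower h
tower>0 zero    = s≤s z≤n
tower>0 (suc h) = m^n>0 2 (tower h)

n<tower : ∀ n → n < tower n
n<tower zero    = s≤s z≤n
n<tower (suc n) = ≤-<-trans (n<tower n) (n<2^n (tower n))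

tower-suc : ∀ {n} h → n ≤ tower h → n < tower (suc h)
tower-suc h n≤ = ≤-<-trans n≤ (n<2^n (tower h))

tower-mono-≤ : ∀ {g h} → g ≤ h → tower g ≤ tower h
tower-mono-≤ {h = h} z≤n       = tower>0 h
tower-mono-≤         (s≤s g≤h) = ^-monoʳ-≤ 2 (tower-mono-≤ g≤h)

-- A crude bound suffices: each arithmetic operation may cost a constant number of levels, since
-- only the linear growth of the final height in `t` matters.
tower-* : ∀ {m n} h → m ≤ tower h → n ≤ tower h → m * n ≤ tower (2 + h)
tower-* {m} {n} h m≤ n≤ = begin
  m * n             ≤⟨ *-mono-≤ m≤ n≤ ⟩
  x * x             ≤⟨ *-mono-≤ (<⇒≤ (n<2^n x)) (<⇒≤ (n<2^n x)) ⟩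
  2 ^ x * 2 ^ x     ≡⟨ ^-distribˡ-+-* 2 x x ⟨
  2 ^ (x + x)       ≡⟨ cong (λ y → 2 ^ (x + y)) (+-identityʳ x) ⟨
  2 ^ (2 * x)       ≤⟨ ^-monoʳ-≤ 2 (2n≤2^n x (tower>0 h)) ⟩
  tower (2 + h)     ∎
  where
  open ≤-Reasoning
  x = tower h

tower-^ : ∀ {m n} h → m ≤ tower h → n ≤ tower h → m ^ n ≤ tower (3 + h)
tower-^ {m} {n} h m≤ n≤ = begin
  m ^ n         ≤⟨ ^-monoˡ-≤ n (<⇒≤ (n<2^n m)) ⟩
  (2 ^ m) ^ n   ≡⟨ ^-*-assoc 2 m n ⟩
  2 ^ (m * n)   ≤⟨ ^-monoʳ-≤ 2 (tower-* h m≤ n≤) ⟩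
  tower (3 + h) ∎
  where open ≤-Reasoning

iteratedExp-tower : ∀ m {k} h → k ≤ tower h → iteratedExp m k ≤ tower (m + h)
iteratedExp-tower zero    h k≤ = k≤
iteratedExp-tower (suc m) {k} h k≤ =
  subst (λ g → iteratedExp m (2 ^ k) ≤ tower g) (+-suc m h)
    (iteratedExp-tower m (suc h) (^-monoʳ-≤ 2 {k} k≤))

m+k≤iteratedExp : ∀ m k → m + k ≤ iteratedExp m k
m+k≤iteratedExp zero    k = ≤-refl
m+k≤iteratedExp (suc m) k = begin
  suc m + k                 ≡⟨ +-suc m k ⟨
  m + suc k                 ≤⟨ +-monoʳ-≤ m (n<2^n k) ⟩
  m + 2 ^ k                 ≤⟨ m+k≤iteratedExp m (2 ^ k) ⟩
  iteratedExp m (2 ^ k)     ∎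
  where open ≤-Reasoning

-- Colourings of increasing tuples

-- Constant beyond the end of the vector.
at : ∀ {A : Set} {m} → Vec A (suc m) → ℕ → A
at (x ∷ c)     zero    = x
at (x ∷ [])    (suc i) = x
at (x ∷ y ∷ c) (suc i) = at (y ∷ c) i

at-tail : ∀ {A : Set} {m} (c : Vec A (2 + m)) i → at (tail c) i ≡ at c (suc i)
at-tail (x ∷ y ∷ c) i = refl

-- The bound on `i` is sharp in general: from index `m` on, `at (init c)` is constant, whereas `c`
-- has one more entry.
at-init : ∀ {A : Set} {m} (c : Vec A (2 + m)) {i} → i ≤ m → at (init c) i ≡ at c i
at-init             (x ∷ y ∷ c)     z≤n       = refl
at-init {m = suc m} (x ∷ y ∷ z ∷ c) (s≤s i≤m) = at-init (y ∷ z ∷ c) i≤m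

-- Concerns the entries c 0, …, c m only.
Increasing : ∀ {N} → (ℕ → Fin N) → ℕ → Set
Increasing c m = ∀ {i} → i < m → c i Fin.< c (suc i)

increasing? : ∀ {N} (c : ℕ → Fin N) m → Dec (Increasing c m)
increasing? c = allUpTo? (λ i → c i Finₚ.<? c (suc i))

increasing-∷ : ∀ {N m} {x : Fin N} (c : Vec (Fin N) (suc m)) →
               x Fin.< at c 0 → Increasing (at c) m → Increasing (at (x ∷ c)) (suc m)
increasing-∷ (y ∷ c) x< inc {zero}  i<m       = x<
increasing-∷ (y ∷ c) x< inc {suc i} (s≤s i<m) = inc i<m

increasing-init : ∀ {N m} (c : Vec (Fin N) (suc (suc m))) →
                  Increasing (at c) (suc m) → Increasing (at (init c)) m
increasing-init c inc i<m =
  subst₂ Fin._<_ (sym (at-init c (<⇒≤ i<m))) (sym (at-init c i<m)) (inc (m≤n⇒m≤1+n i<m))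

increasing-tail : ∀ {N m} (c : Vec (Fin N) (suc (suc m))) →
                  Increasing (at c) (suc m) → Increasing (at (tail c)) m
increasing-tail c inc {i} i<m =
  subst₂ Fin._<_ (sym (at-tail c i)) (sym (at-tail c (suc i))) (inc (s≤s i<m))

funToFin-injective : ∀ {m n} (f g : Fin m → Fin n) →
                     funToFin f ≡ funToFin g → ∀ i → f i ≡ g i
funToFin-injective f g eq i =
  trans (sym (Finₚ.finToFun-funToFin f i))
    (trans (cong (λ k → finToFun k i) eq) (Finₚ.finToFun-funToFin g i))

vecToFin : ∀ {n k} → Vec (Fin n) k → Fin (n ^ k)
vecToFin = funToFin ∘ lookup

finToVec : ∀ {n k} → Fin (n ^ k) → Vec (Fin n) k
finToVec = tabulate ∘ finToFun

finToVec-vecToFin : ∀ {n k} (v : Vec (Fin n) k) → finToVec (vecToFin v) ≡ v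
finToVec-vecToFin v =
  trans (tabulate-cong (Finₚ.finToFun-funToFin (lookup v))) (tabulate∘lookup v)

bit : Bool → Fin 2
bit b = if b then suc zero else zero

bit-injective : ∀ {a b} → bit a ≡ bit b → a ≡ b
bit-injective {false} {false} _ = refl
bit-injective {true}  {true}  _ = refl

-- Colour a tuple c by the set of colours f (x ∷ c) over all x below its head.
-- If c₁,…,cₘ and c₂,…,cₘ₊₁ get the same set, then f (c₁ ∷ …) is also
-- the colour of x ∷ c₁ ∷ … ∷ cₘ for some x < c₁.
shift : ∀ {N} m {k} → iteratedExp m k < N → (f : Vec (Fin N) (suc m) → Fin k) →
        ∃ λ (c : Vec (Fin N) (2 + m)) →
          Increasing (at c) (suc m) × f (init c) ≡ f (tail c)
shift zero k<N f with Finₚ.pigeonhole k<N (λ x → f (x ∷ []))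
... | x , y , x<y , eq = x ∷ y ∷ [] , (λ { (s≤s z≤n) → x<y }) , eq
shift {N} (suc m) {k} e<N f with shift m e<N heads
  where
  Head : Vec (Fin N) (suc m) → Fin k → Fin N → Set
  Head c κ x = x Fin.< at c 0 × f (x ∷ c) ≡ κ

  head? : ∀ c κ → Dec (∃ (Head c κ))
  head? c κ = Finₚ.any? λ x → (x Finₚ.<? at c 0) ×-dec (f (x ∷ c) Finₚ.≟ κ)

  isHead : Vec (Fin N) (suc m) → Fin k → Fin 2
  isHead c κ = bit (does (head? c κ))

  heads : Vec (Fin N) (suc m) → Fin (2 ^ k)
  heads c = funToFin (isHead c)
... | c@(y ∷ z ∷ c′) , inc , eq
  -- These are `head? (init c) (f c)` and `head? (tail c) (f c)` written out, so that matching on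
  -- them turns the equality of bits at the colour `f c` into one of truth values. The second answer
  -- is yes because of the head `y`; hence so is the first.
  with Finₚ.any? (λ x → (x Finₚ.<? y) ×-dec (f (x ∷ init c) Finₚ.≟ f c))
     | Finₚ.any? (λ x → (x Finₚ.<? z) ×-dec (f (x ∷ z ∷ c′) Finₚ.≟ f c))
     | bit-injective (funToFin-injective _ _ eq (f c))
... | yes (x , x<y , fx) | _     | _ = x ∷ c , increasing-∷ c x<y inc , fx
... | no _               | no ¬h | _ = ⊥-elim (¬h (y , inc (s≤s z≤n) , refl))

-- Locality

element : ∀ {n} (S : Subset n) → Fin ∣ S ∣ → ∃ λ u → u ∈ S
element (inside  ∷ S) zero    = zero , here
element (inside  ∷ S) (suc i) = let u , u∈S = element S i in suc u , there u∈S
element (outside ∷ S) i       = let u , u∈S = element S i in suc u , there u∈S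

rank : ∀ {n} (S : Subset n) {u} → u ∈ S → Fin ∣ S ∣
rank (inside  ∷ S) here        = zero
rank (inside  ∷ S) (there u∈S) = suc (rank S u∈S)
rank (outside ∷ S) (there u∈S) = rank S u∈S

element-rank : ∀ {n} (S : Subset n) {u} (u∈S : u ∈ S) → element S (rank S u∈S) ≡ (u , u∈S)
element-rank (inside  ∷ S) here        = refl
element-rank (inside  ∷ S) (there u∈S) rewrite element-rank S u∈S = refl
element-rank (outside ∷ S) (there u∈S) rewrite element-rank S u∈S = refl

rank-element : ∀ {n} (S : Subset n) i → rank S (proj₂ (element S i)) ≡ i
rank-element (inside  ∷ S) zero    = refl
rank-element (inside  ∷ S) (suc i) = cong suc (rank-element S i)
rank-element (outside ∷ S) i       = rank-element S i

Fin∣∣↔ : ∀ {n} (S : Subset n) → Fin ∣ S ∣ ↔ ∃ λ u → u ∈ S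
Fin∣∣↔ S = mk↔ₛ′ (element S) (λ (_ , u∈S) → rank S u∈S)
  (λ (_ , u∈S) → element-rank S u∈S) (rank-element S)

indexIdentifiers : ∀ {n c} (G : SimpleGraph n) → 1 ≤ c → Identifiers G c
indexIdentifiers {n} {c} G 1≤c = record
  { id       = λ v → suc (toℕ v)
  ; positive = λ v → s≤s z≤n
  ; bounded  = λ v → ≤-trans (Finₚ.toℕ<n v) (n≤n^c v)
  ; unique   = λ eq → Finₚ.toℕ-injective (suc-injective eq)
  }
  where
  n≤n^c : Fin n → n ≤ n ^ c
  n≤n^c v = subst (_≤ n ^ c) (^-identityʳ n)
              -- The existence of the node `v` provides the instance that `n` is nonzero.
              (^-monoʳ-≤ n {{Finₚ.nonZeroIndex v}} 1≤c)

-- Listing neighbours in increasing order makes the ports of a node a function of its neighbour set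
-- alone. Graphs with equal neighbour sets at a node thus have equal ports there.
sortedPorts : ∀ {n} (G : SimpleGraph n) → PortNumbering G
sortedPorts G v = Fin∣∣↔ (SimpleGraph.neighbours G v)

module _ {n : ℕ} (G G′ : SimpleGraph n) where
  open SimpleGraph G using () renaming (neighbours to N)
  open SimpleGraph G′ using () renaming (neighbours to N′)

  -- Both graphs live on the same nodes and hence carry the same identifiers, so equality of
  -- neighbour sets throughout the ball of radius `t` takes the place of an isomorphism of views.
  AgreeAround : ℕ → Fin n → Set
  AgreeAround zero    v = N v ≡ N′ v
  AgreeAround (suc t) v = AgreeAround t v × (∀ {u} → u ∈ N v → AgreeAround t u)

  agree-neighbours : ∀ t {v} → AgreeAround t v → N v ≡ N′ v
  agree-neighbours zero    eq      = eq
  agree-neighbours (suc t) (h , _) = agree-neighbours t h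

module Locality {Output : Set} (A : LocalAlgorithm Output) {n c : ℕ} (1≤c : 1 ≤ c) where
  open LocalAlgorithm A renaming (init to start)

  module Run (G : SimpleGraph n) =
    Execution A {n} {c} G (sortedPorts G) (indexIdentifiers G 1≤c)

  -- Lets the running time be rounded up to the `t` for which the grid was built.
  announces-mono : ∀ (G : SimpleGraph n) x {s t} → s ≤ t →
                   Run.AnnouncesWithin G s x → Run.AnnouncesWithin G t x
  announces-mono G x {s} s≤t h = later (≤⇒≤′ s≤t)
    where
    stopped : ∀ {d} (σ : State d) {o} m → output σ ≡ just o → output (update σ m) ≡ just o
    stopped σ m eq rewrite eq = eq

    later : ∀ {t} → s ≤′ t → Run.AnnouncesWithin G t x
    later ≤′-refl           v = h v
    later (≤′-step {t} s≤t) v = stopped (Run.state G t v) _ (later s≤t v)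

  -- States are indexed by degrees, but the transport is along equality of neighbour sets: matching
  -- it with `refl` identifies the ports as well as the degrees.
  transport : {S S′ : Subset n} → S ≡ S′ → State ∣ S ∣ → State ∣ S′ ∣
  transport = subst (λ S → State ∣ S ∣)

  private
    start-agree : ∀ {S S′ : Subset n} (e : S ≡ S′) k →
                  transport e (start ∣ S ∣ k) ≡ start ∣ S′ ∣ k
    start-agree refl k = refl

    update-agree : ∀ {S S′ : Subset n} (e : S ≡ S′) {s s′} → transport e s ≡ s′ →
      (m : (∃ λ u → u ∈ S) → Message) (m′ : (∃ λ u → u ∈ S′) → Message) →
      (∀ {u} (p : u ∈ S) (p′ : u ∈ S′) → m (u , p) ≡ m′ (u , p′)) →
      transport e (update s (tabulate λ i → m (element S i)))
        ≡ update s′ (tabulate λ i → m′ (element S′ i))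
    update-agree {S} refl refl m m′ h =
      cong (update _) (tabulate-cong λ i → let u , p = element S i in h p p)

    -- The two membership proofs come from the symmetry of different graphs. Proof irrelevance gives
    -- them the same rank, so both select the same port.
    send-agree : ∀ {S S′ : Subset n} (e : S ≡ S′) {s s′} → transport e s ≡ s′ →
      ∀ {v} (p : v ∈ S) (p′ : v ∈ S′) →
      lookup (send s) (rank S p) ≡ lookup (send s′) (rank S′ p′)
    send-agree refl refl p p′ rewrite []=-irrelevant p p′ = refl

    output-agree : ∀ {S S′ : Subset n} (e : S ≡ S′) {s s′} → transport e s ≡ s′ →
      (f f′ : Fin n → Output) →
      output s  ≡ just (tabulate λ i → f  (proj₁ (element S i))) →
      output s′ ≡ just (tabulate λ i → f′ (proj₁ (element S′ i))) →
      ∀ {u} → u ∈ S → f u ≡ f′ u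
    output-agree {S} refl refl f f′ o o′ {u} u∈S = begin
      f u                                             ≡⟨ value f ⟨
      lookup (tabulate (λ i → f (proj₁ (element S i)))) r
        ≡⟨ cong (λ xs → lookup xs r) (just-injective (trans (sym o) o′)) ⟩
      lookup (tabulate (λ i → f′ (proj₁ (element S i)))) r
        ≡⟨ value f′ ⟩
      f′ u                                            ∎
      where
      open ≡-Reasoning
      r = rank S u∈S
      value : ∀ g → lookup (tabulate (λ i → g (proj₁ (element S i)))) r ≡ g u
      value g = trans (lookup∘tabulate _ r) (cong (g ∘ proj₁) (element-rank S u∈S))

  module _ (G G′ : SimpleGraph n) where
    open SimpleGraph G using (symmetric) renaming (neighbours to N)
    open SimpleGraph G′ using () renaming (neighbours to N′; symmetric to symmetric′)

    state-agree : ∀ t {v} → AgreeAround G G′ t v → (e : N v ≡ N′ v) →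
                  transport e (Run.state G t v) ≡ Run.state G′ t v
    state-agree zero    _       e = start-agree e _
    state-agree (suc t) {v} (h , hs) e =
      update-agree e (state-agree t h e)
        -- With sorted ports, `oppositePort` unfolds to the rank of `v` among the neighbours of `u`.
        (λ (u , p) → lookup (send (Run.state G t u)) (rank (N u) (symmetric p)))
        (λ (u , p) → lookup (send (Run.state G′ t u)) (rank (N′ u) (symmetric′ p)))
        λ p p′ → send-agree (agree-neighbours G G′ t (hs p))
          (state-agree t (hs p) (agree-neighbours G G′ t (hs p))) (symmetric p) (symmetric′ p′)

    announce-agree : ∀ t {v} (x x′ : Fin n → Fin n → Output) → AgreeAround G G′ t v →
      Run.AnnouncesWithin G t x → Run.AnnouncesWithin G′ t x′ →
      ∀ {u} → u ∈ N v → x v u ≡ x′ v u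
    announce-agree t {v} x x′ h o o′ =
      output-agree e (state-agree t h e) (x v) (x′ v) (o v) (o′ v)
      where e = agree-neighbours G G′ t h

-- Sums over neighbourhoods

∣p∪q∣≤∣p∣+∣q∣ : ∀ {n} (p q : Subset n) → ∣ p ∪ q ∣ ≤ ∣ p ∣ + ∣ q ∣
∣p∪q∣≤∣p∣+∣q∣ []            []            = z≤n
∣p∪q∣≤∣p∣+∣q∣ (outside ∷ p) (outside ∷ q) = ∣p∪q∣≤∣p∣+∣q∣ p q
∣p∪q∣≤∣p∣+∣q∣ (inside  ∷ p) (outside ∷ q) = s≤s (∣p∪q∣≤∣p∣+∣q∣ p q)
∣p∪q∣≤∣p∣+∣q∣ (outside ∷ p) (inside  ∷ q) =
  ≤-trans (s≤s (∣p∪q∣≤∣p∣+∣q∣ p q)) (≤-reflexive (sym (+-suc ∣ p ∣ ∣ q ∣)))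
∣p∪q∣≤∣p∣+∣q∣ (inside  ∷ p) (inside  ∷ q) =
  s≤s (≤-trans (∣p∪q∣≤∣p∣+∣q∣ p q) (+-monoʳ-≤ ∣ p ∣ (n≤1+n ∣ q ∣)))

-- The sum in `load`, with an arbitrary set in place of the neighbourhood, so that it can be split
-- by direction.
weight : ∀ {n} → Subset n → (Fin n → ℚ) → ℚ
weight S f = sum λ u → if lookup S u then f u else 0ℚ

weight-∪ : ∀ {n} (p q : Subset n) f → (∀ {u} → u ∈ p → u ∈ q → ⊥) →
           weight (p ∪ q) f ≡ weight p f ℚ.+ weight q f
weight-∪ p q f disjoint = trans (sum-cong-≗ pointwise) (∑-distrib-+ (restrict p) (restrict q))
  where
  restrict : Subset _ → Fin _ → ℚ
  restrict S u = if lookup S u then f u else 0ℚ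

  pointwise : ∀ u → restrict (p ∪ q) u ≡ restrict p u ℚ.+ restrict q u
  pointwise u rewrite lookup-zipWith _∨_ u p q with lookup p u in eq | lookup q u in eq′
  ... | false | false = sym (ℚₚ.+-identityˡ 0ℚ)
  ... | false | true  = sym (ℚₚ.+-identityˡ (f u))
  ... | true  | false = sym (ℚₚ.+-identityʳ (f u))
  ... | true  | true  = ⊥-elim (disjoint (lookup⇒[]= u p eq) (lookup⇒[]= u q eq′))

weight-⊥ : ∀ {n} (f : Fin n → ℚ) → weight Subset.⊥ f ≡ 0ℚ
weight-⊥ {n} f = trans
  (sum-cong-≗ λ u → cong (λ b → if b then f u else 0ℚ) (lookup-replicate u false))
  (sum-replicate-zero n)

weight-⁅⁆ : ∀ {n} (w : Fin n) f → weight ⁅ w ⁆ f ≡ f w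
weight-⁅⁆ zero    f = trans (cong (f zero ℚ.+_) (weight-⊥ (λ u → f (suc u)))) (ℚₚ.+-identityʳ _)
weight-⁅⁆ (suc w) f = trans (ℚₚ.+-identityˡ _) (weight-⁅⁆ w (λ u → f (suc u)))

optional : ∀ {n} → Maybe (Fin n) → Subset n
optional = maybe ⁅_⁆ Subset.⊥

∈-optional⁺ : ∀ {n} {m : Maybe (Fin n)} {u} → m ≡ just u → u ∈ optional m
∈-optional⁺ refl = x∈⁅x⁆ _

∈-optional⁻ : ∀ {n} {m : Maybe (Fin n)} {u} → u ∈ optional m → m ≡ just u
∈-optional⁻ {m = just w}  u∈ = cong just (sym (x∈⁅y⁆⇒x≡y w u∈))
∈-optional⁻ {m = nothing} u∈ = ⊥-elim (∉⊥ u∈)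

∣optional∣≤1 : ∀ {n} (m : Maybe (Fin n)) → ∣ optional m ∣ ≤ 1
∣optional∣≤1     (just w) = ≤-reflexive (∣⁅x⁆∣≡1 w)
∣optional∣≤1 {n} nothing  = ≤-trans (≤-reflexive (∣⊥∣≡0 n)) z≤n

weight-optional : ∀ {n} (m : Maybe (Fin n)) f → weight (optional m) f ≡ maybe f 0ℚ m
weight-optional (just w) f = weight-⁅⁆ w f
weight-optional nothing  f = weight-⊥ f

-- Grids

-- Disjoint ascending paths on Fin N.
record Line (N : ℕ) : Set where
  field
    next prev : Fin N → Maybe (Fin N)
    next⇒prev : ∀ {a b} → next a ≡ just b → prev b ≡ just a
    prev⇒next : ∀ {a b} → prev b ≡ just a → next a ≡ just b
    ascending : ∀ {a b} → next a ≡ just b → a Fin.< b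

  next≢prev : ∀ {a b} → next a ≡ just b → prev a ≡ just b → ⊥
  next≢prev n p = <-asym (ascending n) (ascending (prev⇒next p))

module Grid {N R : ℕ} (ℓ : Line N) (ρ : Line R) where
  private
    module ℓ = Line ℓ
    module ρ = Line ρ

  -- Directions `0F`, `1F`, `2F`, `3F` are left, right, below and above; `nothing` marks the absence
  -- of a neighbour.
  move : Fin N → Fin R → Fin 4 → Maybe (Fin (N * R))
  move a b 0F = map (λ a′ → combine a′ b) (ℓ.prev a)
  move a b 1F = map (λ a′ → combine a′ b) (ℓ.next a)
  move a b 2F = map (combine a) (ρ.prev b)
  move a b 3F = map (combine a) (ρ.next b)

  around : Fin N → Fin R → Subset (N * R)
  around a b = (optional (move a b 0F) ∪ optional (move a b 1F))
             ∪ (optional (move a b 2F) ∪ optional (move a b 3F))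

  ∈-around⁺ : ∀ {a b} d {u} → move a b d ≡ just u → u ∈ around a b
  ∈-around⁺ 0F eq = x∈p∪q⁺ (inj₁ (x∈p∪q⁺ (inj₁ (∈-optional⁺ eq))))
  ∈-around⁺ 1F eq = x∈p∪q⁺ (inj₁ (x∈p∪q⁺ (inj₂ (∈-optional⁺ eq))))
  ∈-around⁺ 2F eq = x∈p∪q⁺ (inj₂ (x∈p∪q⁺ (inj₁ (∈-optional⁺ eq))))
  ∈-around⁺ 3F eq = x∈p∪q⁺ (inj₂ (x∈p∪q⁺ (inj₂ (∈-optional⁺ eq))))

  data Step (a : Fin N) (b : Fin R) : Fin 4 → Fin (N * R) → Set where
    prevˡ : ∀ {a′} → ℓ.prev a ≡ just a′ → Step a b 0F (combine a′ b)
    nextˡ : ∀ {a′} → ℓ.next a ≡ just a′ → Step a b 1F (combine a′ b)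
    prevʳ : ∀ {b′} → ρ.prev b ≡ just b′ → Step a b 2F (combine a b′)
    nextʳ : ∀ {b′} → ρ.next b ≡ just b′ → Step a b 3F (combine a b′)

  step : ∀ {a b} d {u} → move a b d ≡ just u → Step a b d u
  step {a} {b} 0F eq with ℓ.prev a in p | eq
  ... | just _ | refl = prevˡ p
  step {a} {b} 1F eq with ℓ.next a in p | eq
  ... | just _ | refl = nextˡ p
  step {a} {b} 2F eq with ρ.prev b in p | eq
  ... | just _ | refl = prevʳ p
  step {a} {b} 3F eq with ρ.next b in p | eq
  ... | just _ | refl = nextʳ p

  ∈-around⁻ : ∀ {a b u} → u ∈ around a b → ∃ λ d → Step a b d u
  ∈-around⁻ u∈ with x∈p∪q⁻ _ _ u∈
  ... | inj₁ u∈ˡ with x∈p∪q⁻ _ _ u∈ˡ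
  ...   | inj₁ u∈₀ = 0F , step 0F (∈-optional⁻ u∈₀)
  ...   | inj₂ u∈₁ = 1F , step 1F (∈-optional⁻ u∈₁)
  ∈-around⁻ u∈ | inj₂ u∈ʳ with x∈p∪q⁻ _ _ u∈ʳ
  ...   | inj₁ u∈₂ = 2F , step 2F (∈-optional⁻ u∈₂)
  ...   | inj₂ u∈₃ = 3F , step 3F (∈-optional⁻ u∈₃)

  neighbours : Fin (N * R) → Subset (N * R)
  neighbours v = uncurry around (remQuot R v)

  neighbours-combine : ∀ a b → neighbours (combine a b) ≡ around a b
  neighbours-combine a b = cong (uncurry around) (Finₚ.remQuot-combine a b)

  step-sym : ∀ {a b d u} → Step a b d u → combine a b ∈ neighbours u
  step-sym {a} {b} (prevˡ {a′} p) = subst (_ ∈_) (sym (neighbours-combine a′ b))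
    (∈-around⁺ 1F (cong (map _) (ℓ.prev⇒next p)))
  step-sym {a} {b} (nextˡ {a′} p) = subst (_ ∈_) (sym (neighbours-combine a′ b))
    (∈-around⁺ 0F (cong (map _) (ℓ.next⇒prev p)))
  step-sym {a} {b} (prevʳ {b′} p) = subst (_ ∈_) (sym (neighbours-combine a b′))
    (∈-around⁺ 3F (cong (map _) (ρ.prev⇒next p)))
  step-sym {a} {b} (nextʳ {b′} p) = subst (_ ∈_) (sym (neighbours-combine a b′))
    (∈-around⁺ 2F (cong (map _) (ρ.next⇒prev p)))

  step-irrefl : ∀ {a b d u} → Step a b d u → u ≢ combine a b
  step-irrefl {a} {b} (prevˡ {a′} p) eq =
    Finₚ.<⇒≢ (ℓ.ascending (ℓ.prev⇒next p)) (Finₚ.combine-injectiveˡ a′ b a b eq)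
  step-irrefl {a} {b} (nextˡ {a′} p) eq =
    Finₚ.<⇒≢ (ℓ.ascending p) (sym (Finₚ.combine-injectiveˡ a′ b a b eq))
  step-irrefl {a} {b} (prevʳ {b′} p) eq =
    Finₚ.<⇒≢ (ρ.ascending (ρ.prev⇒next p)) (Finₚ.combine-injectiveʳ a b′ a b eq)
  step-irrefl {a} {b} (nextʳ {b′} p) eq =
    Finₚ.<⇒≢ (ρ.ascending p) (sym (Finₚ.combine-injectiveʳ a b′ a b eq))

  graph : SimpleGraph (N * R)
  graph = record
    { neighbours = neighbours
    ; symmetric  = λ {u} {v} v∈ → subst (_∈ neighbours v) (Finₚ.combine-remQuot {N} R u)
                     (step-sym (proj₂ (∈-around⁻ v∈)))
    ; loopless   = λ {v} v∈ → step-irrefl (proj₂ (∈-around⁻ v∈))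
                     (sym (Finₚ.combine-remQuot {N} R v))
    }

  ∣around∣≤4 : ∀ a b → ∣ around a b ∣ ≤ 4
  ∣around∣≤4 a b =
    ≤-trans (∣p∪q∣≤∣p∣+∣q∣ (optional (move a b 0F) ∪ optional (move a b 1F)) _)
      (+-mono-≤ (pair (move a b 0F) (move a b 1F)) (pair (move a b 2F) (move a b 3F)))
    where
    pair : ∀ m m′ → ∣ optional m ∪ optional m′ ∣ ≤ 2
    pair m m′ = ≤-trans (∣p∪q∣≤∣p∣+∣q∣ (optional m) (optional m′))
                  (+-mono-≤ (∣optional∣≤1 m) (∣optional∣≤1 m′))

  maxDegree : SimpleGraph.MaxDegree≤ graph 4
  maxDegree v = ∣around∣≤4 _ _

  moves-disjointˡ : ∀ {a b u} → move a b 0F ≡ just u → move a b 1F ≡ just u → ⊥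
  moves-disjointˡ {a} {b} p q with ℓ.prev a in eq | ℓ.next a in eq′ | p | q
  ... | just a₀ | just a₁ | refl | q′ = ℓ.next≢prev eq′
    (trans eq (cong just (sym (Finₚ.combine-injectiveˡ a₁ b a₀ b (just-injective q′)))))

  moves-disjointʳ : ∀ {a b u} → move a b 2F ≡ just u → move a b 3F ≡ just u → ⊥
  moves-disjointʳ {a} {b} p q with ρ.prev b in eq | ρ.next b in eq′ | p | q
  ... | just b₀ | just b₁ | refl | q′ = ρ.next≢prev eq′
    (trans eq (cong just (sym (Finₚ.combine-injectiveʳ a b₁ a b₀ (just-injective q′)))))

  -- A horizontal move changes the first coordinate and a vertical one keeps it.
  moves-disjointˡʳ : ∀ {a b u} →
                     u ∈ optional (move a b 0F) ⊎ u ∈ optional (move a b 1F) →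
                     u ∈ optional (move a b 2F) ⊎ u ∈ optional (move a b 3F) → ⊥
  moves-disjointˡʳ {a} {b} {u} p q with horizontal p | vertical q
    where
    horizontal : u ∈ optional (move a b 0F) ⊎ u ∈ optional (move a b 1F) →
                 ∃ λ a′ → a′ ≢ a × u ≡ combine a′ b
    horizontal (inj₁ p) with step {a} {b} 0F (∈-optional⁻ p)
    ... | prevˡ eq = _ , Finₚ.<⇒≢ (ℓ.ascending (ℓ.prev⇒next eq)) , refl
    horizontal (inj₂ p) with step {a} {b} 1F (∈-optional⁻ p)
    ... | nextˡ eq = _ , (λ a′≡a → Finₚ.<⇒≢ (ℓ.ascending eq) (sym a′≡a)) , refl

    vertical : u ∈ optional (move a b 2F) ⊎ u ∈ optional (move a b 3F) →
               ∃ λ b′ → u ≡ combine a b′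
    vertical (inj₁ q) with step {a} {b} 2F (∈-optional⁻ q)
    ... | prevʳ _ = _ , refl
    vertical (inj₂ q) with step {a} {b} 3F (∈-optional⁻ q)
    ... | nextʳ _ = _ , refl
  ... | a′ , a′≢a , eq | b′ , eq′ =
    a′≢a (Finₚ.combine-injectiveˡ a′ b a b′ (trans (sym eq) eq′))

  module _ (x : Fin (N * R) → Fin (N * R) → ℚ) where

    -- The default 0 for an absent edge makes every load a sum of four terms, at the boundary too.
    flow : Fin N → Fin R → Fin 4 → ℚ
    flow a b d = maybe (x (combine a b)) 0ℚ (move a b d)

    load-flow : ∀ a b → load graph x (combine a b)
                      ≡ (flow a b 0F ℚ.+ flow a b 1F) ℚ.+ (flow a b 2F ℚ.+ flow a b 3F)
    load-flow a b = trans (cong (λ S → weight S f) (neighbours-combine a b))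
      (trans (weight-∪ _ _ f λ p q → moves-disjointˡʳ {a} {b} (x∈p∪q⁻ _ _ p) (x∈p∪q⁻ _ _ q))
        (cong₂ ℚ._+_
          (trans (weight-∪ _ _ f λ p q → moves-disjointˡ {a} {b} (∈-optional⁻ p) (∈-optional⁻ q))
            (cong₂ ℚ._+_ (weight-optional (move a b 0F) f) (weight-optional (move a b 1F) f)))
          (trans (weight-∪ _ _ f λ p q → moves-disjointʳ {a} {b} (∈-optional⁻ p) (∈-optional⁻ q))
            (cong₂ ℚ._+_ (weight-optional (move a b 2F) f) (weight-optional (move a b 3F) f)))))
      where f = x (combine a b)

-- Paths through increasing sequences

module Chain {N : ℕ} (c : ℕ → Fin N) (m : ℕ) (inc : Increasing c m) where

  monotone : ∀ {i j} → i <′ j → j ≤ m → c i Fin.< c j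
  monotone ≤′-refl       j≤m = inc j≤m
  monotone (≤′-step i<j) j≤m = <-trans (monotone i<j (<⇒≤ j≤m)) (inc j≤m)

  injective : ∀ {i j} → i ≤ m → j ≤ m → c i ≡ c j → i ≡ j
  injective {i} {j} i≤m j≤m eq with <-cmp i j
  ... | tri< i<j _ _ = ⊥-elim (Finₚ.<⇒≢ (monotone (≤⇒≤′ i<j) j≤m) eq)
  ... | tri≈ _ i≡j _ = i≡j
  ... | tri> _ _ j<i = ⊥-elim (Finₚ.<⇒≢ (monotone (≤⇒≤′ j<i) i≤m) (sym eq))

  -- The position of a node is searched for; as `c` is increasing, at most one position can be
  -- found.
  next prev : Fin N → Maybe (Fin N)
  next a with anyUpTo? (λ i → c i Finₚ.≟ a) m
  ... | yes (i , _) = just (c (suc i))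
  ... | no  _       = nothing
  prev b with anyUpTo? (λ i → c (suc i) Finₚ.≟ b) m
  ... | yes (i , _) = just (c i)
  ... | no  _       = nothing

  next-c : ∀ {i} → i < m → next (c i) ≡ just (c (suc i))
  next-c {i} i<m with anyUpTo? (λ j → c j Finₚ.≟ c i) m
  ... | yes (j , j<m , eq) =
    cong (λ k → just (c (suc k))) (injective (<⇒≤ j<m) (<⇒≤ i<m) eq)
  ... | no  ¬∃             = ⊥-elim (¬∃ (i , i<m , refl))

  prev-c : ∀ {i} → i < m → prev (c (suc i)) ≡ just (c i)
  prev-c {i} i<m with anyUpTo? (λ j → c (suc j) Finₚ.≟ c (suc i)) m
  ... | yes (j , j<m , eq) =
    cong (λ k → just (c k)) (suc-injective (injective j<m i<m eq))
  ... | no  ¬∃             = ⊥-elim (¬∃ (i , i<m , refl))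

  prev-c₀ : prev (c 0) ≡ nothing
  prev-c₀ with anyUpTo? (λ j → c (suc j) Finₚ.≟ c 0) m
  ... | yes (j , j<m , eq) with () ← injective j<m z≤n eq
  ... | no  _              = refl

  next⇒index : ∀ {a b} → next a ≡ just b → ∃ λ i → i < m × c i ≡ a × c (suc i) ≡ b
  next⇒index {a} eq with anyUpTo? (λ i → c i Finₚ.≟ a) m
  ... | yes (i , i<m , ci≡a) = i , i<m , ci≡a , just-injective eq

  prev⇒index : ∀ {a b} → prev b ≡ just a → ∃ λ i → i < m × c i ≡ a × c (suc i) ≡ b
  prev⇒index {b = b} eq with anyUpTo? (λ i → c (suc i) Finₚ.≟ b) m
  ... | yes (i , i<m , ci≡b) = i , i<m , just-injective eq , ci≡b

  chain : Line N
  chain = record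
    { next      = next
    ; prev      = prev
    ; next⇒prev = λ eq → let i , i<m , p , q = next⇒index eq in
                  subst₂ (λ a b → prev b ≡ just a) p q (prev-c i<m)
    ; prev⇒next = λ eq → let i , i<m , p , q = prev⇒index eq in
                  subst₂ (λ a b → next a ≡ just b) p q (next-c i<m)
    ; ascending = λ eq → let i , i<m , p , q = next⇒index eq in
                  subst₂ Fin._<_ p q (inc i<m)
    }

emptyLine : ∀ N → Line N
emptyLine N = record
  { next = λ _ → nothing ; prev = λ _ → nothing
  ; next⇒prev = λ () ; prev⇒next = λ () ; ascending = λ () }

-- Without edges if c is not increasing, so that it is defined for every tuple.
opaque
  line : ∀ {N m} → Vec (Fin N) (suc m) → Line N
  line {N} {m} c with increasing? (at c) m
  ... | yes inc = Chain.chain (at c) m inc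
  ... | no  _   = emptyLine N

module _ {N m : ℕ} (c : Vec (Fin N) (suc m)) (inc : Increasing (at c) m) where
  open Line (line c)

  opaque
    unfolding line

    line-next : ∀ {i} → i < m → next (at c i) ≡ just (at c (suc i))
    line-next with increasing? (at c) m
    ... | yes inc′ = Chain.next-c (at c) m inc′
    ... | no  ¬inc = ⊥-elim (¬inc inc)

    line-prev : ∀ {i} → i < m → prev (at c (suc i)) ≡ just (at c i)
    line-prev with increasing? (at c) m
    ... | yes inc′ = Chain.prev-c (at c) m inc′
    ... | no  ¬inc = ⊥-elim (¬inc inc)

    line-prev₀ : prev (at c 0) ≡ nothing
    line-prev₀ with increasing? (at c) m
    ... | yes inc′ = Chain.prev-c₀ (at c) m inc′
    ... | no  ¬inc = ⊥-elim (¬inc inc)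

-- Locality in lines and grids

module _ {N : ℕ} (ℓ ℓ′ : Line N) where
  open Line ℓ
  open Line ℓ′ using () renaming (next to next′; prev to prev′)

  LineAgree : ℕ → Fin N → Set
  LineAgree zero    a = prev a ≡ prev′ a × next a ≡ next′ a
  LineAgree (suc t) a = LineAgree t a
    × (∀ {b} → prev a ≡ just b → LineAgree t b) × (∀ {b} → next a ≡ just b → LineAgree t b)

  lineAgree-here : ∀ t {a} → LineAgree t a → prev a ≡ prev′ a × next a ≡ next′ a
  lineAgree-here zero    h       = h
  lineAgree-here (suc t) (h , _) = lineAgree-here t h

lineAgree-refl : ∀ {N} (ℓ : Line N) t {a} → LineAgree ℓ ℓ t a
lineAgree-refl ℓ zero    = refl , refl
lineAgree-refl ℓ (suc t) =
  lineAgree-refl ℓ t , (λ _ → lineAgree-refl ℓ t) , (λ _ → lineAgree-refl ℓ t)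

-- The window c 0, …, c m sits at offset o in the sequence c′.
module _ {N m m′} (c : Vec (Fin N) (suc m)) (c′ : Vec (Fin N) (suc m′)) (o : ℕ)
         (inc : Increasing (at c) m) (inc′ : Increasing (at c′) m′) (o+m≤m′ : o + m ≤ m′)
         (window : ∀ {i} → i ≤ m → at c i ≡ at c′ (o + i)) where

  private
    module ℓ  = Line (line c)
    module ℓ′ = Line (line c′)

    o+suc≤m′ : ∀ {i} → suc i ≤ m → suc (o + i) ≤ m′
    o+suc≤m′ {i} i<m = ≤-trans (≤-reflexive (sym (+-suc o i)))
                         (≤-trans (+-monoʳ-≤ o i<m) o+m≤m′)

    window-suc : ∀ {i} → suc i ≤ m → at c (suc i) ≡ at c′ (suc (o + i))
    window-suc {i} i<m = trans (window i<m) (cong (at c′) (+-suc o i))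

    prev-agree : ∀ {i} → suc i ≤ m → ℓ.prev (at c (suc i)) ≡ ℓ′.prev (at c (suc i))
    prev-agree {i} i<m = begin
      ℓ.prev (at c (suc i))          ≡⟨ line-prev c inc i<m ⟩
      just (at c i)                  ≡⟨ cong just (window (<⇒≤ i<m)) ⟩
      just (at c′ (o + i))           ≡⟨ line-prev c′ inc′ (o+suc≤m′ i<m) ⟨
      ℓ′.prev (at c′ (suc (o + i)))  ≡⟨ cong ℓ′.prev (window-suc i<m) ⟨
      ℓ′.prev (at c (suc i))         ∎
      where open ≡-Reasoning

    next-agree : ∀ {i} → suc i ≤ m → ℓ.next (at c i) ≡ ℓ′.next (at c i)
    next-agree {i} i<m = begin
      ℓ.next (at c i)                ≡⟨ line-next c inc i<m ⟩
      just (at c (suc i))            ≡⟨ cong just (window-suc i<m) ⟩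
      just (at c′ (suc (o + i)))     ≡⟨ line-next c′ inc′ (o+suc≤m′ i<m) ⟨
      ℓ′.next (at c′ (o + i))        ≡⟨ cong ℓ′.next (window (<⇒≤ i<m)) ⟨
      ℓ′.next (at c i)               ∎
      where open ≡-Reasoning

  -- The two bounds keep every position within distance `t` of `suc i` strictly between the ends of
  -- the window. Both neighbours of such a position lie in the window, so the cut at its ends goes
  -- unnoticed.
  window-agree : ∀ t {i} → t ≤ i → suc (suc i + t) ≤ m →
                 LineAgree (line c) (line c′) t (at c (suc i))
  window-agree zero {i} _ i<m = prev-agree (<⇒≤ i<m′) , next-agree i<m′
    where i<m′ = subst (λ k → suc (suc k) ≤ m) (+-identityʳ i) i<m
  window-agree (suc t) {suc i} (s≤s t≤i) i+t<m =
      window-agree t (m≤n⇒m≤1+n t≤i) (<⇒≤ i+t<m′)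
    , (λ eq → transfer (line-prev c inc (≤-trans (s≤s (s≤s (m≤m+n i t))) (<⇒≤ (<⇒≤ i+t<m′)))) eq
                (window-agree t t≤i (<⇒≤ (<⇒≤ i+t<m′))))
    , (λ eq → transfer (line-next c inc (≤-trans (s≤s (s≤s (s≤s (m≤m+n i t)))) (<⇒≤ i+t<m′))) eq
                (window-agree t (m≤n⇒m≤1+n (m≤n⇒m≤1+n t≤i)) i+t<m′))
    where
    i+t<m′ : suc (suc (suc (suc i + t))) ≤ m
    i+t<m′ = subst (λ k → suc (suc (suc k)) ≤ m) (+-suc i t) i+t<m

    transfer : ∀ {z : Maybe (Fin N)} {a b} → z ≡ just a → z ≡ just b →
               LineAgree (line c) (line c′) t a → LineAgree (line c) (line c′) t b
    transfer refl refl h = h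

module _ {N R : ℕ} {ℓ ℓ′ : Line N} {ρ ρ′ : Line R} where
  private
    module G  = Grid ℓ ρ
    module G′ = Grid ℓ′ ρ′

  move-agree : ∀ t {a b} → LineAgree ℓ ℓ′ t a → LineAgree ρ ρ′ t b →
               ∀ d → G.move a b d ≡ G′.move a b d
  move-agree t h k 0F = cong (map _) (proj₁ (lineAgree-here ℓ ℓ′ t h))
  move-agree t h k 1F = cong (map _) (proj₂ (lineAgree-here ℓ ℓ′ t h))
  move-agree t h k 2F = cong (map _) (proj₁ (lineAgree-here ρ ρ′ t k))
  move-agree t h k 3F = cong (map _) (proj₂ (lineAgree-here ρ ρ′ t k))

  -- A grid step moves along one line and stays put on the other. For the latter, the successor case
  -- of `LineAgree` also stores agreement at radius `t` at the same place.
  grid-agree : ∀ t {a b} → LineAgree ℓ ℓ′ t a → LineAgree ρ ρ′ t b →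
               AgreeAround G.graph G′.graph t (combine a b)
  grid-agree zero {a} {b} h k = trans (G.neighbours-combine a b)
    (trans (cong₂ _∪_ (cong₂ _∪_ (eq 0F) (eq 1F)) (cong₂ _∪_ (eq 2F) (eq 3F)))
      (sym (G′.neighbours-combine a b)))
    where
    eq : ∀ d → optional (G.move a b d) ≡ optional (G′.move a b d)
    eq d = cong optional (move-agree 0 h k d)
  grid-agree (suc t) {a} {b} (h , hp , hn) (k , kp , kn) = grid-agree t h k , λ u∈ →
    around (proj₂ (G.∈-around⁻ (subst (_ ∈_) (G.neighbours-combine a b) u∈)))
    where
    around : ∀ {d u} → G.Step a b d u → AgreeAround G.graph G′.graph t u
    around (G.prevˡ eq) = grid-agree t (hp eq) k
    around (G.nextˡ eq) = grid-agree t (hn eq) k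
    around (G.prevʳ eq) = grid-agree t h (kp eq)
    around (G.nextʳ eq) = grid-agree t h (kn eq)

-- Half-integral values

Integral HalfIntegral : ℚ → Set
Integral     q = q ≡ 0ℚ ⊎ q ≡ 1ℚ
HalfIntegral q = q ≡ 0ℚ ⊎ q ≡ ½ ⊎ q ≡ 1ℚ

-- Since `p` is half-integral, `p + p` is an integer, and so is `r`, being 1 minus integers; this
-- excludes ½.
saturated-integral : ∀ {p q r} → HalfIntegral p → Integral q → HalfIntegral r →
                     (p ℚ.+ p) ℚ.+ (q ℚ.+ r) ≡ 1ℚ → Integral r
saturated-integral _ _ (inj₁ r≡0)        _ = inj₁ r≡0
saturated-integral _ _ (inj₂ (inj₂ r≡1)) _ = inj₂ r≡1
saturated-integral (inj₁ refl)        (inj₁ refl) (inj₂ (inj₁ refl)) ()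
saturated-integral (inj₁ refl)        (inj₂ refl) (inj₂ (inj₁ refl)) ()
saturated-integral (inj₂ (inj₁ refl)) (inj₁ refl) (inj₂ (inj₁ refl)) ()
saturated-integral (inj₂ (inj₁ refl)) (inj₂ refl) (inj₂ (inj₁ refl)) ()
saturated-integral (inj₂ (inj₂ refl)) (inj₁ refl) (inj₂ (inj₁ refl)) ()
saturated-integral (inj₂ (inj₂ refl)) (inj₂ refl) (inj₂ (inj₁ refl)) ()

-- The left side is an even integer.
doubled-integral-≢1 : ∀ {p q} → Integral p → Integral q → (p ℚ.+ p) ℚ.+ (q ℚ.+ q) ≡ 1ℚ → ⊥
doubled-integral-≢1 (inj₁ refl) (inj₁ refl) ()
doubled-integral-≢1 (inj₁ refl) (inj₂ refl) ()
doubled-integral-≢1 (inj₂ refl) (inj₁ refl) ()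
doubled-integral-≢1 (inj₂ refl) (inj₂ refl) ()

code : ℚ → Fin 3
code q with q ℚₚ.≟ 0ℚ | q ℚₚ.≟ ½
... | yes _ | _     = 0F
... | no  _ | yes _ = 1F
-- All other rationals share this code; decoding is claimed for half-integral values only.
... | no  _ | no  _ = 2F

decode : Fin 3 → ℚ
decode 0F = 0ℚ
decode 1F = ½
decode 2F = 1ℚ

decode-code : ∀ {q} → HalfIntegral q → decode (code q) ≡ q
decode-code (inj₁ refl)        = refl
decode-code (inj₂ (inj₁ refl)) = refl
decode-code (inj₂ (inj₂ refl)) = refl

-- Opaque, as powers of the literal 81 unfold into huge sums during type checking.
opaque
  nodeColours : ℕ
  nodeColours = 3 ^ 4

  colouring : (Fin 4 → ℚ) → Fin nodeColours
  colouring f = funToFin (code ∘ f)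

  colouring-injective : ∀ {f g} → (∀ d → HalfIntegral (f d)) → (∀ d → HalfIntegral (g d)) →
                        colouring f ≡ colouring g → ∀ d → f d ≡ g d
  colouring-injective {f} {g} hf hg eq d = trans (sym (decode-code (hf d)))
    (trans (cong decode (funToFin-injective (code ∘ f) (code ∘ g) eq d)) (decode-code (hg d)))

  nodeColours≤tower : nodeColours ≤ tower 4
  nodeColours≤tower = ≤ᵇ⇒≤ (3 ^ 4) (tower 4) _

-- The parity argument

module GridSolutions (A : LocalAlgorithm ℚ) {c : ℕ} (1≤c : 1 ≤ c) (t N R : ℕ)
  (solve : (G : SimpleGraph (N * R)) → SimpleGraph.MaxDegree≤ G 4 →
    ∃ λ x → Locality.Run.AnnouncesWithin A 1≤c G t x × IsMaximalHalfIntegralMatching G x)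
  where
  open Locality A {N * R} 1≤c

  -- A window has `suc M`, that is 2t + 3, entries: the centre and t + 1 on each side, as
  -- `window-agree` demands. The sequence found by `shift` has `L` entries and contains two windows,
  -- offset by one.
  M L : ℕ
  M = suc (suc t + t)
  L = suc (suc M)

  centre : ℕ
  centre = suc t

  centre≤M : centre ≤ M
  centre≤M = s≤s (m≤n⇒m≤1+n (m≤m+n t t))

  module Solution (ℓ : Line N) (ρ : Line R) where
    open Grid ℓ ρ hiding (flow)

    x : Fin (N * R) → Fin (N * R) → ℚ
    x = proj₁ (solve graph maxDegree)

    announces : Run.AnnouncesWithin graph t x
    announces = proj₁ (proj₂ (solve graph maxDegree))

    open IsMaximalHalfIntegralMatching (proj₂ (proj₂ (solve graph maxDegree))) public
    open IsMaximalFractionalMatching isMaximalFractionalMatching public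
    open IsFractionalMatching isFractionalMatching public

    flow : Fin N → Fin R → Fin 4 → ℚ
    flow = Grid.flow ℓ ρ x

    move⇒∈ : ∀ {a b} d {u} → move a b d ≡ just u → u ∈ neighbours (combine a b)
    move⇒∈ {a} {b} d eq = subst (_ ∈_) (sym (neighbours-combine a b)) (∈-around⁺ d eq)

    flow-halfIntegral : ∀ a b d → HalfIntegral (flow a b d)
    flow-halfIntegral a b d with move a b d in eq
    ... | just u  = halfIntegral (move⇒∈ d eq)
    ... | nothing = inj₁ refl

    colour : Fin N → Fin R → Fin nodeColours
    colour a b = colouring (flow a b)

    flow-prevˡ : ∀ {a a′ b} → Line.next ℓ a ≡ just a′ → flow a′ b 0F ≡ flow a b 1F
    flow-prevˡ {a} {a′} {b} eq rewrite eq | Line.next⇒prev ℓ eq =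
      well-defined (move⇒∈ 0F (cong (map _) (Line.next⇒prev ℓ eq)))

    flow-prevʳ : ∀ {a b b′} → Line.next ρ b ≡ just b′ → flow a b′ 2F ≡ flow a b 3F
    flow-prevʳ {a} {b} {b′} eq rewrite eq | Line.next⇒prev ρ eq =
      well-defined (move⇒∈ 2F (cong (map _) (Line.next⇒prev ρ eq)))

    flow-prevˡ₀ : ∀ {a b} → Line.prev ℓ a ≡ nothing → flow a b 0F ≡ 0ℚ
    flow-prevˡ₀ {a} {b} eq = cong (maybe (x (combine a b)) 0ℚ ∘ map _) eq

    flow-prevʳ₀ : ∀ {a b} → Line.prev ρ b ≡ nothing → flow a b 2F ≡ 0ℚ
    flow-prevʳ₀ {a} {b} eq = cong (maybe (x (combine a b)) 0ℚ ∘ map _) eq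

    flow-total : Fin N → Fin R → ℚ
    flow-total a b = (flow a b 0F ℚ.+ flow a b 1F) ℚ.+ (flow a b 2F ℚ.+ flow a b 3F)

    flow-total-cong : ∀ {a b a′ b′} → (∀ d → flow a b d ≡ flow a′ b′ d) →
                      flow-total a b ≡ flow-total a′ b′
    flow-total-cong h = cong₂ ℚ._+_ (cong₂ ℚ._+_ (h 0F) (h 1F)) (cong₂ ℚ._+_ (h 2F) (h 3F))

    -- One of two adjacent nodes is saturated, so if their flows agree both are.
    twin-saturated : ∀ {a b a′ b′} d → move a b d ≡ just (combine a′ b′) →
                     (∀ e → flow a b e ≡ flow a′ b′ e) → flow-total a b ≡ 1ℚ
    twin-saturated {a} {b} {a′} {b′} d eq twins with saturated (move⇒∈ d eq)
    ... | inj₁ h = trans (sym (load-flow x a b)) h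
    ... | inj₂ h = trans (flow-total-cong twins) (trans (sym (load-flow x a′ b′)) h)

  open Solution using (flow; colour)

  colour⇒flow : ∀ {ℓ ρ a b ℓ′ ρ′ a′ b′} → colour ℓ ρ a b ≡ colour ℓ′ ρ′ a′ b′ →
                ∀ d → flow ℓ ρ a b d ≡ flow ℓ′ ρ′ a′ b′ d
  colour⇒flow {ℓ} {ρ} {a} {b} {ℓ′} {ρ′} {a′} {b′} eq d = colouring-injective
    (Solution.flow-halfIntegral ℓ ρ a b) (Solution.flow-halfIntegral ℓ′ ρ′ a′ b′) eq d

  flow-local : ∀ {ℓ ℓ′ ρ ρ′ a b} → LineAgree ℓ ℓ′ t a → LineAgree ρ ρ′ t b →
               ∀ d → flow ℓ ρ a b d ≡ flow ℓ′ ρ′ a b d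
  flow-local {ℓ} {ℓ′} {ρ} {ρ′} {a} {b} h k d
    with Grid.move ℓ ρ a b d in eq | Grid.move ℓ′ ρ′ a b d | move-agree {ℓ = ℓ} {ℓ′} {ρ} {ρ′} t h k d
  ... | nothing | _ | refl = refl
  ... | just u  | _ | refl =
    announce-agree (Grid.graph ℓ ρ) (Grid.graph ℓ′ ρ′) t
      (Solution.x ℓ ρ) (Solution.x ℓ′ ρ′) (grid-agree t h k)
      (Solution.announces ℓ ρ) (Solution.announces ℓ′ ρ′) (Solution.move⇒∈ ℓ ρ d eq)

  -- Since r is chosen after c, the colour of c records the column for every r.
  columnCell : Vec (Fin N) (suc M) → Vec (Fin R) L → Fin L → Fin nodeColours
  columnCell c r j = colour (line c) (line r) (at c centre) (at r (toℕ j))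

  columnFor : Vec (Fin N) (suc M) → Fin (R ^ L) → Fin (nodeColours ^ L)
  columnFor c q = funToFin (columnCell c (finToVec q))

  columnColour : Vec (Fin N) (suc M) → Fin ((nodeColours ^ L) ^ (R ^ L))
  columnColour c = funToFin (columnFor c)

  -- By now the columns are fixed, so `c` enters with all `L` entries and only `r` is a window.
  rowCell : Vec (Fin N) L → Vec (Fin R) (suc M) → Fin L → Fin nodeColours
  rowCell c r i = colour (line c) (line r) (at c (toℕ i)) (at r centre)

  rowColour : Vec (Fin N) L → Vec (Fin R) (suc M) → Fin (nodeColours ^ L)
  rowColour c r = funToFin (rowCell c r)

  init-window-agree : ∀ {K} (c : Vec (Fin K) L) → Increasing (at c) (suc M) →
                      LineAgree (line (init c)) (line c) t (at c centre)
  init-window-agree c inc = subst (LineAgree (line (init c)) (line c) t) (at-init c centre≤M)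
    (window-agree (init c) c 0 (increasing-init c inc) inc (n≤1+n M) (at-init c) t ≤-refl ≤-refl)

  -- The centre of the second window is entry `suc centre` of the whole sequence, so the two windows
  -- are centred at adjacent nodes.
  tail-window-agree : ∀ {K} (c : Vec (Fin K) L) → Increasing (at c) (suc M) →
                      LineAgree (line (tail c)) (line c) t (at c (suc centre))
  tail-window-agree c inc = subst (LineAgree (line (tail c)) (line c) t) (at-tail c centre)
    (window-agree (tail c) c 1 (increasing-tail c inc) inc ≤-refl (λ {i} _ → at-tail c i) t ≤-refl ≤-refl)

  module _ (c : Vec (Fin N) L) (c↑ : Increasing (at c) (suc M))
           (c-shift : columnColour (init c) ≡ columnColour (tail c))
           (r : Vec (Fin R) L) (r↑ : Increasing (at r) (suc M))
           (r-shift : rowColour c (init r) ≡ rowColour c (tail r)) where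
    open Solution (line c) (line r) hiding (flow; colour; x)

    F : ℕ → ℕ → Fin 4 → ℚ
    F i j = flow (line c) (line r) (at c i) (at r j)

    -- By locality, cutting `c` down to either window preserves the outputs along the column through
    -- the centre of that window, and `c-shift` equates the two columns.
    column-shift : ∀ {j} → j < L → ∀ d → F centre j d ≡ F (suc centre) j d
    column-shift {j} j<L d = begin
      F centre j d
        ≡⟨ flow-local (init-window-agree c c↑) (lineAgree-refl (line r) t) d ⟨
      flow (line (init c)) (line r) (at c centre) (at r j) d
        ≡⟨ cong (λ a → flow (line (init c)) (line r) a (at r j) d) (at-init c centre≤M) ⟨
      flow (line (init c)) (line r) (at (init c) centre) (at r j) d
        ≡⟨ colour⇒flow colours d ⟩
      flow (line (tail c)) (line r) (at (tail c) centre) (at r j) d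
        ≡⟨ cong (λ a → flow (line (tail c)) (line r) a (at r j) d) (at-tail c centre) ⟩
      flow (line (tail c)) (line r) (at c (suc centre)) (at r j) d
        ≡⟨ flow-local (tail-window-agree c c↑) (lineAgree-refl (line r) t) d ⟩
      F (suc centre) j d ∎
      where
      open ≡-Reasoning
      colours : colour (line (init c)) (line r) (at (init c) centre) (at r j)
              ≡ colour (line (tail c)) (line r) (at (tail c) centre) (at r j)
      -- The equality of column colours is evaluated at the code of the actual `r` and at cell `j`;
      -- the substitution undoes both codings.
      colours = subst₂ (λ r k → colour (line (init c)) (line r) (at (init c) centre) (at r k)
                              ≡ colour (line (tail c)) (line r) (at (tail c) centre) (at r k))
        (finToVec-vecToFin r) (Finₚ.toℕ-fromℕ< j<L)
        (funToFin-injective (columnCell (init c) (finToVec q)) (columnCell (tail c) (finToVec q))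
          (funToFin-injective (columnFor (init c)) (columnFor (tail c)) c-shift q) (fromℕ< j<L))
        where q = vecToFin r

    row-shift : ∀ {i} → i < L → ∀ d → F i centre d ≡ F i (suc centre) d
    row-shift {i} i<L d = begin
      F i centre d
        ≡⟨ flow-local (lineAgree-refl (line c) t) (init-window-agree r r↑) d ⟨
      flow (line c) (line (init r)) (at c i) (at r centre) d
        ≡⟨ cong (λ b → flow (line c) (line (init r)) (at c i) b d) (at-init r centre≤M) ⟨
      flow (line c) (line (init r)) (at c i) (at (init r) centre) d
        ≡⟨ colour⇒flow colours d ⟩
      flow (line c) (line (tail r)) (at c i) (at (tail r) centre) d
        ≡⟨ cong (λ b → flow (line c) (line (tail r)) (at c i) b d) (at-tail r centre) ⟩
      flow (line c) (line (tail r)) (at c i) (at r (suc centre)) d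
        ≡⟨ flow-local (lineAgree-refl (line c) t) (tail-window-agree r r↑) d ⟩
      F i (suc centre) d ∎
      where
      open ≡-Reasoning
      colours : colour (line c) (line (init r)) (at c i) (at (init r) centre)
              ≡ colour (line c) (line (tail r)) (at c i) (at (tail r) centre)
      colours = subst (λ k → colour (line c) (line (init r)) (at c k) (at (init r) centre)
                           ≡ colour (line c) (line (tail r)) (at c k) (at (tail r) centre))
        (Finₚ.toℕ-fromℕ< i<L)
        (funToFin-injective (rowCell c (init r)) (rowCell c (tail r)) r-shift (fromℕ< i<L))

    nextˡ : ∀ {i} → i ≤ M → Line.next (line c) (at c i) ≡ just (at c (suc i))
    nextˡ i≤M = line-next c c↑ (s≤s i≤M)

    nextʳ : ∀ {j} → j ≤ M → Line.next (line r) (at r j) ≡ just (at r (suc j))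
    nextʳ j≤M = line-next r r↑ (s≤s j≤M)

    -- The edge to the right is the left edge of the twin node in the next column.
    column-straight : ∀ {j} → j < L → F centre j 1F ≡ F centre j 0F
    column-straight j<L = trans (sym (flow-prevˡ (nextˡ centre≤M))) (sym (column-shift j<L 0F))

    row-straight : ∀ {i} → i < L → F i centre 3F ≡ F i centre 2F
    row-straight i<L = trans (sym (flow-prevʳ (nextʳ centre≤M))) (sym (row-shift i<L 2F))

    column-saturated : ∀ {j} → j < L →
      (F centre j 0F ℚ.+ F centre j 0F) ℚ.+ (F centre j 2F ℚ.+ F centre j 3F) ≡ 1ℚ
    column-saturated {j} j<L = trans
      (cong (λ q → (F centre j 0F ℚ.+ q) ℚ.+ (F centre j 2F ℚ.+ F centre j 3F)) (sym (column-straight j<L)))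
      (twin-saturated 1F (cong (map _) (nextˡ centre≤M)) (column-shift j<L))

    row-saturated : ∀ {i} → i < L →
      (F i centre 2F ℚ.+ F i centre 2F) ℚ.+ (F i centre 0F ℚ.+ F i centre 1F) ≡ 1ℚ
    row-saturated {i} i<L = trans (ℚₚ.+-comm (F i centre 2F ℚ.+ F i centre 2F) _) (trans
      (cong (λ q → (F i centre 0F ℚ.+ F i centre 1F) ℚ.+ (F i centre 2F ℚ.+ q)) (sym (row-straight i<L)))
      (twin-saturated 3F (cong (map _) (nextʳ centre≤M)) (row-shift i<L)))

    column-integral : ∀ j → j ≤ centre → Integral (F centre j 2F)
    -- The lowest node has no neighbour below, so `flow` takes its default 0.
    column-integral zero    _   = inj₁ (flow-prevʳ₀ (line-prev₀ r r↑))
    column-integral (suc j) j<C = subst Integral (sym (flow-prevʳ (nextʳ j≤M)))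
      (saturated-integral (flow-halfIntegral _ _ 0F) (column-integral j (<⇒≤ j<C))
        (flow-halfIntegral _ _ 3F) (column-saturated (s≤s (m≤n⇒m≤1+n j≤M))))
      where
      j≤M : j ≤ M
      j≤M = ≤-trans (<⇒≤ j<C) centre≤M

    row-integral : ∀ i → i ≤ centre → Integral (F i centre 0F)
    row-integral zero    _   = inj₁ (flow-prevˡ₀ (line-prev₀ c c↑))
    row-integral (suc i) i<C = subst Integral (sym (flow-prevˡ (nextˡ i≤M)))
      (saturated-integral (flow-halfIntegral _ _ 2F) (row-integral i (<⇒≤ i<C))
        (flow-halfIntegral _ _ 1F) (row-saturated (s≤s (m≤n⇒m≤1+n i≤M))))
      where
      i≤M : i ≤ M
      i≤M = ≤-trans (<⇒≤ i<C) centre≤M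

    shifts-impossible : ⊥
    shifts-impossible = doubled-integral-≢1
      (row-integral centre ≤-refl) (column-integral centre ≤-refl)
      (trans (cong (λ q → (F centre centre 0F ℚ.+ F centre centre 0F) ℚ.+ (F centre centre 2F ℚ.+ q))
               (sym (row-straight centre<L)))
        (column-saturated centre<L))
      where
      centre<L : centre < L
      centre<L = s≤s (m≤n⇒m≤1+n centre≤M)

  impossible : iteratedExp M ((nodeColours ^ L) ^ (R ^ L)) < N →
               iteratedExp M (nodeColours ^ L) < R → ⊥
  impossible N-large R-large =
    let c , c↑ , c-shift = shift M N-large columnColour
        r , r↑ , r-shift = shift M R-large (rowColour c)
    in shifts-impossible c c↑ c-shift r r↑ r-shift

-- Bounds on the number of nodes

module Sizes (t : ℕ) where
  M L k₂ R k₁ N : ℕ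
  M  = suc (suc t + t)
  L  = suc (suc M)
  k₂ = nodeColours ^ L
  R  = suc (iteratedExp M k₂)
  k₁ = k₂ ^ (R ^ L)
  N  = suc (iteratedExp M k₁)

  -- A power costs three levels by `tower-^`, each of the `M` exponentials one, and the final `suc`
  -- one. The 7 is 4 for `nodeColours` plus one power; the 6 is the two nested powers in `k₁`.
  R-height N-height : ℕ
  R-height = suc (M + (7 + L))
  N-height = suc (M + (6 + R-height))

  L≤R-height : 7 + L ≤ R-height
  L≤R-height = m≤n⇒m≤1+n (m≤n+m (7 + L) M)

  k₂≤tower : k₂ ≤ tower (7 + L)
  k₂≤tower = tower-^ (4 + L)
    (≤-trans nodeColours≤tower (tower-mono-≤ (m≤m+n 4 L)))
    (≤-trans (<⇒≤ (n<tower L)) (tower-mono-≤ (m≤n+m L 4)))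

  R≤tower : R ≤ tower R-height
  R≤tower = tower-suc (M + (7 + L)) (iteratedExp-tower M (7 + L) k₂≤tower)

  k₁≤tower : k₁ ≤ tower (6 + R-height)
  k₁≤tower = tower-^ (3 + R-height)
    (≤-trans k₂≤tower (tower-mono-≤ (≤-trans L≤R-height (m≤n+m R-height 3))))
    (tower-^ R-height R≤tower (≤-trans (<⇒≤ (n<tower L))
      (tower-mono-≤ (≤-trans (m≤n+m L 7) L≤R-height))))

  N≤tower : N ≤ tower N-height
  N≤tower = tower-suc (M + (6 + R-height)) (iteratedExp-tower M (6 + R-height) k₁≤tower)

  R≤N-height : R-height ≤ N-height
  R≤N-height = m≤n⇒m≤1+n (≤-trans (m≤n+m R-height 6) (m≤n+m (6 + R-height) M))

  log*-size : log* (N * R) ≤ 2 + N-height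
  log*-size = iteratedLog-tower (N * R) (2 + N-height)
    (tower-* N-height N≤tower (≤-trans R≤tower (tower-mono-≤ R≤N-height)))

  height : 2 + N-height ≡ 25 + 6 * t
  height = identity t
    where
    -- All abbreviations are unfolded so that the solver sees a polynomial in `t`.
    identity : ∀ t → 2 + suc (suc (suc t + t) + (6 + suc (suc (suc t + t) +
                 (7 + suc (suc (suc (suc t + t))))))) ≡ 25 + 6 * t
    identity = solve-∀

  -- Puts the number of nodes beyond the threshold from which the little-o bound applies.
  t≤size : t ≤ N * R
  t≤size = begin
    t                  ≤⟨ m≤n+m t (suc (suc t)) ⟩
    M                  ≤⟨ m≤m+n M k₁ ⟩
    M + k₁             ≤⟨ m+k≤iteratedExp M k₁ ⟩
    iteratedExp M k₁   ≤⟨ n≤1+n _ ⟩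
    N                  ≤⟨ m≤m*n N R ⟩
    N * R              ∎
    where open ≤-Reasoning

-- Contradiction with a running time in o(log* n)

corollary1p4 : (c : ℕ) → 1 ≤ c →
    ¬ (∃ λ (A : LocalAlgorithm ℚ) → ∃ λ (T : ℕ → ℕ) →
    T ∈o[ log* ] × FindsMaximalHalfIntegralMatching 4 c A T)
corollary1p4 c 1≤c (A , T , T∈o , finds) =
  GridSolutions.impossible A 1≤c t N R solve ≤-refl ≤-refl
  where
  t : ℕ
  -- The threshold for ε = 1/31, plus one to make `t` positive. Then log* of the size is at most 25
  -- + 6t, hence at most 31t, which bounds the running time by `t`.
  t = suc (proj₁ (T∈o 31))

  open Sizes t

  T≤t : T (N * R) ≤ t
  T≤t = *-cancelˡ-≤ 31 (begin
    31 * T (N * R)     ≤⟨ proj₂ (T∈o 31) (N * R) (≤-trans (n≤1+n _) t≤size) ⟩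
    log* (N * R)       ≤⟨ log*-size ⟩
    2 + N-height       ≡⟨ height ⟩
    25 + 6 * t         ≤⟨ +-monoˡ-≤ (6 * t) (*-monoʳ-≤ 25 {1} {t} (s≤s z≤n)) ⟩
    25 * t + 6 * t     ≡⟨ *-distribʳ-+ t 25 6 ⟨
    31 * t             ∎)
    where open ≤-Reasoning

  solve : (G : SimpleGraph (N * R)) → SimpleGraph.MaxDegree≤ G 4 →
    ∃ λ x → Locality.Run.AnnouncesWithin A 1≤c G t x × IsMaximalHalfIntegralMatching G x
  solve G deg≤4 =
    let x , announces , maximal = finds G deg≤4 (sortedPorts G) (indexIdentifiers G 1≤c)
    in x , Locality.announces-mono A 1≤c G x T≤t announces , maximal
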